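{- For $n\ge0$ let $C_n^{(4)}=\frac{4}{2n+4}\binom{2n+4}{n}$ and let $D(n,4)=\det\bigl(C_{i+j}^{(4)}\bigr)_{i,j=0}^{n-1}$. Then $(D(n,4))_{n\ge 0}=(1,1,-2,-2,3,3,-4,-4,\dots)$, i.e. for all integers $n\ge 0$ $$D(2n,4)=D(2n+1,4)=(-1)^n(n+1).$$
   Context: The numbers $C_n^{(4)}$ are the coefficients of the fourth power of the Catalan generating function: $\sum_{n\ge0}C_n^{(4)}z^n=\bigl(\sum_{n\ge0}C_nz^n\bigr)^4$ with $C_n=\frac1{n+1}\binom{2n}{n}$. The determinant of the empty ($0\times 0$) matrix is $1$. -}

module Defs where

open import Algebra.Bundles using (CommutativeRing)
open import Data.Fin.Base using (Fin; zero; suc; toℕ; punchIn)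
open import Data.Integer.Base using (+_)
open import Data.Nat.Base using (ℕ; zero; suc; _+_; _*_)
open import Data.Nat.Combinatorics using (_C_)
open import Data.Rational.Base using (ℚ; _/_) renaming (_*_ to _*ℚ_)
open import Data.Rational.Properties using (+-*-commutativeRing)
open import Data.Vec.Functional using (Vector)

module Determinant {c ℓ} (R : CommutativeRing c ℓ) where
  open CommutativeRing R using (Carrier; 1#; -_; semiring) renaming (_*_ to _·_)
  open import Algebra.Properties.Semiring.Sum semiring using (sum)
  open import Algebra.Properties.Semiring.Exp semiring using (_^_)

  SquareMatrix : ℕ → Set c
  SquareMatrix n = Vector (Vector Carrier n) n

  -- Delete the first row and column j.
  minor : ∀ {n} → SquareMatrix (suc n) → Fin (suc n) → SquareMatrix n
  minor M j i k = M (suc i) (punchIn j k)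

  -- Laplace expansion along the first row.
  det : ∀ {n} → SquareMatrix n → Carrier
  det {zero}  M = 1#
  det {suc n} M = sum λ j → ((- 1#) ^ toℕ j) · (M zero j · det (minor M j))

open Determinant +-*-commutativeRing public

-- The divisor 4 + 2 * n is 2n+4, ordered so that it is visibly nonzero.
C⁽⁴⁾ : ℕ → ℚ
C⁽⁴⁾ n = (+ 4 / (4 + 2 * n)) *ℚ (+ ((2 * n + 4) C n) / 1)

hankel : (ℕ → ℚ) → (n : ℕ) → SquareMatrix n
hankel a n i j = a (toℕ i + toℕ j)

D⁽⁴⁾ : ℕ → ℚ
D⁽⁴⁾ n = det (hankel C⁽⁴⁾ n)

{-# OPTIONS --safe #-}
module Submission where

-- Let Λ be the functional with Λ(xⁿ) = Cₙ₊₁ and pₖ(x) = Uₖ((x - 2)/2) its monic orthogonal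
-- polynomials. Since C⁽⁴⁾ₙ = Λ(xⁿ x (x - 2)), Christoffel's formula gives the orthogonal
-- polynomials q of the moments C⁽⁴⁾: x (x - 2) q is a combination of pₙ₊₂, pₙ₊₁, pₙ
-- vanishing at 0 and 2. If n = 2m it is pₙ₊₂ + 2 pₙ₊₁ + pₙ = x pₙ₊₁, and if n = 2m + 1 it
-- is, up to the factor m + 1, (m + 1) pₙ₊₂ - (m + 2) pₙ. Using the coefficients of q for a
-- column operation, det Hₙ₊₁ = det Hₙ in the first case and (m + 1) det Hₙ₊₁ = - (m + 2) det Hₙ
-- in the second.

open import Defs
open import Data.Nat.Base using (ℕ; _+_; _*_)
open import Data.Integer.Base using (+_; -1ℤ) renaming (_*_ to _*ℤ_; _^_ to _^ℤ_)
open import Data.Product.Base using (_×_)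
open import Data.Rational.Base using (_/_)
open import Relation.Binary.PropositionalEquality.Core using (_≡_)

open import Algebra.Bundles using (CommutativeRing)
open import Algebra.Morphism.Structures using (module RingMorphisms)
open import Data.Empty using (⊥-elim)
open import Data.Fin.Base using (Fin; zero; suc; toℕ; fromℕ; fromℕ<; inject₁; punchIn; punchOut)
open import Data.Fin.Induction using (<-weakInduction)
import Data.Fin.Properties as Fin
open import Data.Integer.Base using (ℤ; 0ℤ; 1ℤ; -[1+_]) renaming (-_ to -ℤ_; _+_ to _+ℤ_; _-_ to _-ℤ_)
import Data.Integer.Properties as ℤ
open import Data.Integer.Tactic.RingSolver using (solve-∀)
open import Data.Nat.Base using (zero; suc; _∸_; _≤_; _<_; z≤n; s≤s)
open import Data.Nat.Combinatorics using (_C_; nCn≡1; nC1≡n; nCk≡nC[n∸k]; k>n⇒nCk≡0; nCk+nC[k+1]≡[n+1]C[k+1])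
import Data.Nat.Properties as ℕ
import Data.Nat.Tactic.RingSolver as ℕ-Solver
open import Data.Rational.Base using (ℚ; toℚᵘ)
import Data.Rational.Base as ℚ
import Data.Rational.Properties as ℚ
open import Data.Rational.Unnormalised.Base using (mkℚᵘ; _≃_; *≡*)
import Data.Rational.Unnormalised.Base as ℚᵘ
import Data.Rational.Unnormalised.Properties as ℚᵘ
open import Data.Product.Base using (_,_; proj₁; ∃-syntax)
open import Data.Vec.Functional using (Vector; insertAt)
open import Data.Vec.Functional.Properties using (insertAt-lookup)
open import Function.Base using (_∘_; id)
open import Relation.Binary.PropositionalEquality.Core using (_≢_; refl; sym; trans; cong; cong₂; subst)
open import Relation.Binary.PropositionalEquality.Properties using (module ≡-Reasoning)
open import Relation.Nullary.Decidable.Core using (yes; no)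

open RingMorphisms using (IsRingHomomorphism)

-- Adjacent and last positions under deletion and insertion.

punchIn-inject₁-self : ∀ {n} (k : Fin n) → punchIn (inject₁ k) k ≡ suc k
punchIn-inject₁-self zero    = refl
punchIn-inject₁-self (suc k) = cong suc (punchIn-inject₁-self k)

punchIn-suc-self : ∀ {n} (k : Fin n) → punchIn (suc k) k ≡ inject₁ k
punchIn-suc-self zero    = refl
punchIn-suc-self (suc k) = cong suc (punchIn-suc-self k)

punchIn-inject₁-suc : ∀ {n} (k l : Fin n) → l ≢ k → punchIn (inject₁ k) l ≡ punchIn (suc k) l
punchIn-inject₁-suc zero    zero    l≢k = ⊥-elim (l≢k refl)
punchIn-inject₁-suc zero    (suc l) l≢k = refl
punchIn-inject₁-suc (suc k) zero    l≢k = refl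
punchIn-inject₁-suc (suc k) (suc l) l≢k = cong suc (punchIn-inject₁-suc k l (l≢k ∘ cong suc))

punchIn-inject₁ : ∀ {n} (j : Fin (suc n)) (l : Fin n) →
                  punchIn (inject₁ j) (inject₁ l) ≡ inject₁ (punchIn j l)
punchIn-inject₁ zero    l       = refl
punchIn-inject₁ (suc j) zero    = refl
punchIn-inject₁ (suc j) (suc l) = cong suc (punchIn-inject₁ j l)

punchIn-inject₁-fromℕ : ∀ {n} (j : Fin (suc n)) → punchIn (inject₁ j) (fromℕ n) ≡ fromℕ (suc n)
punchIn-inject₁-fromℕ         zero    = refl
punchIn-inject₁-fromℕ {suc n} (suc j) = cong suc (punchIn-inject₁-fromℕ j)

-- Deleting an index outside an adjacent pair leaves the pair adjacent; this is what lets column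
-- swaps pass to minors in `det-swap`.
punchOut-adjacent : ∀ {n} (j : Fin (suc (suc n))) (k : Fin (suc n)) → j ≢ inject₁ k → j ≢ suc k →
                    ∃[ k′ ] (punchIn j (inject₁ k′) ≡ inject₁ k × punchIn j (suc k′) ≡ suc k)
punchOut-adjacent         zero          zero    j≢k _    = ⊥-elim (j≢k refl)
punchOut-adjacent         zero          (suc k) _   _    = k , refl , refl
punchOut-adjacent         (suc zero)    zero    _   j≢k′ = ⊥-elim (j≢k′ refl)
punchOut-adjacent {suc n} (suc (suc j)) zero    _   _    = zero , refl , refl
punchOut-adjacent {suc n} (suc j)       (suc k) p   q
  with k′ , eq , eq′ ← punchOut-adjacent j k (p ∘ cong suc) (q ∘ cong suc)
  = suc k′ , cong suc eq , cong suc eq′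

module _ {a} {A : Set a} where

  insertAt-minimal : ∀ {n} (xs : Vector A n) k {u v} j → j ≢ k → insertAt xs k u j ≡ insertAt xs k v j
  insertAt-minimal         xs zero    zero    j≢k = ⊥-elim (j≢k refl)
  insertAt-minimal         xs zero    (suc j) j≢k = refl
  insertAt-minimal {suc n} xs (suc k) zero    j≢k = refl
  insertAt-minimal {suc n} xs (suc k) (suc j) j≢k = insertAt-minimal (xs ∘ suc) k j (j≢k ∘ cong suc)

  insertAt-inject₁-suc : ∀ {n} (xs : Vector A n) k v j → j ≢ inject₁ k → j ≢ suc k →
                         insertAt xs (inject₁ k) v j ≡ insertAt xs (suc k) v j
  insertAt-inject₁-suc {suc n} xs zero    v zero          p q = ⊥-elim (p refl)
  insertAt-inject₁-suc {suc n} xs zero    v (suc zero)    p q = ⊥-elim (q refl)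
  insertAt-inject₁-suc {suc n} xs zero    v (suc (suc j)) p q = refl
  insertAt-inject₁-suc {suc n} xs (suc k) v zero          p q = refl
  insertAt-inject₁-suc {suc n} xs (suc k) v (suc j)       p q =
    insertAt-inject₁-suc (xs ∘ suc) k v j (p ∘ cong suc) (q ∘ cong suc)

  insertAt-inject₁-at-suc : ∀ {n} (xs : Vector A n) k v → insertAt xs (inject₁ k) v (suc k) ≡ xs k
  insertAt-inject₁-at-suc {suc n} xs zero    v = refl
  insertAt-inject₁-at-suc {suc n} xs (suc k) v = insertAt-inject₁-at-suc (xs ∘ suc) k v

  insertAt-suc-at-inject₁ : ∀ {n} (xs : Vector A n) k v → insertAt xs (suc k) v (inject₁ k) ≡ xs k
  insertAt-suc-at-inject₁ {suc n} xs zero    v = refl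
  insertAt-suc-at-inject₁ {suc n} xs (suc k) v = insertAt-suc-at-inject₁ (xs ∘ suc) k v

  insertAt-fromℕ-inject₁ : ∀ {n} (xs : Vector A n) v j → insertAt xs (fromℕ n) v (inject₁ j) ≡ xs j
  insertAt-fromℕ-inject₁ {suc n} xs v zero    = refl
  insertAt-fromℕ-inject₁ {suc n} xs v (suc j) = insertAt-fromℕ-inject₁ (xs ∘ suc) v j

  insertAt-fromℕ-toℕ : ∀ n (f : ℕ → A) j → insertAt {n = n} (f ∘ toℕ) (fromℕ n) (f n) j ≡ f (toℕ j)
  insertAt-fromℕ-toℕ zero    f zero    = refl
  insertAt-fromℕ-toℕ (suc n) f zero    = refl
  insertAt-fromℕ-toℕ (suc n) f (suc j) = insertAt-fromℕ-toℕ n (f ∘ suc) j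

-- Determinants as alternating multilinear functions of the columns.

module ColumnOperations {c ℓ} (R : CommutativeRing c ℓ) where
  open CommutativeRing R hiding (zero; _+_; _*_)
    renaming (refl to ≈-refl; sym to ≈-sym; trans to ≈-trans; reflexive to ≈-reflexive)
  open CommutativeRing R using () renaming (_+_ to _⊕_; _*_ to _·_)
  open Determinant R public using () renaming (SquareMatrix to Matrix; minor to minorᴿ; det to detᴿ)
  open import Algebra.Properties.Semiring.Exp semiring using () renaming (_^_ to _^ᴿ_)
  open import Algebra.Properties.Semiring.Sum semiring
    using (sum; sum-cong-≋; ∑-distrib-+; *-distribˡ-sum; sum-replicate-zero; sum-init-last)

  import Algebra.Solver.Ring.NaturalCoefficients.Default commutativeSemiring as Solver
  open import Relation.Binary.Reasoning.Setoid setoid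

  sum-zero : ∀ {n} (h : Vector Carrier n) → (∀ j → h j ≈ 0#) → sum h ≈ 0#
  sum-zero {n} h h≈0 = ≈-trans (sum-cong-≋ h≈0) (sum-replicate-zero n)

  sum-adjacent-cancel : ∀ {n} (k : Fin n) (h : Vector Carrier (suc n)) →
                        (∀ j → j ≢ inject₁ k → j ≢ suc k → h j ≈ 0#) →
                        h (inject₁ k) ⊕ h (suc k) ≈ 0# → sum h ≈ 0#
  sum-adjacent-cancel {suc n} zero h off cancel = begin
    h zero ⊕ (h (suc zero) ⊕ sum (λ j → h (suc (suc j))))  ≈⟨ +-assoc _ _ _ ⟨
    h zero ⊕ h (suc zero) ⊕ sum (λ j → h (suc (suc j)))    ≈⟨ +-cong cancel (sum-zero _ λ j → off (suc (suc j)) (λ ()) (λ ())) ⟩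
    0# ⊕ 0#                                        ≈⟨ +-identityˡ 0# ⟩
    0#                                             ∎
  sum-adjacent-cancel {suc n} (suc k) h off cancel = begin
    h zero ⊕ sum (h ∘ suc)  ≈⟨ +-cong (off zero (λ ()) (λ ()))
                                 (sum-adjacent-cancel k (h ∘ suc)
                                   (λ j p q → off (suc j) (p ∘ Fin.suc-injective) (q ∘ Fin.suc-injective)) cancel) ⟩
    0# ⊕ 0#                 ≈⟨ +-identityˡ 0# ⟩
    0#                      ∎

  cofactor : ∀ {n} → Matrix (suc n) → Fin (suc n) → Carrier
  cofactor M j = ((- 1#) ^ᴿ toℕ j) · (M zero j · detᴿ (minorᴿ M j))

  det-cong : ∀ {n} {A B : Matrix n} → (∀ i j → A i j ≈ B i j) → detᴿ A ≈ detᴿ B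
  det-cong {zero}  A≈B = ≈-refl
  det-cong {suc n} {A} {B} A≈B = sum-cong-≋ {x = cofactor A} {y = cofactor B} λ j →
    *-congˡ (*-cong (A≈B zero j) (det-cong λ i k → A≈B (suc i) (punchIn j k)))

  -- In the expansion along the first row, the term at `k` is linear through its entry, its minor
  -- being common to all three matrices; the other terms are linear through their minors, by
  -- induction.
  det-linear : ∀ {n} (k : Fin n) x y {M A B : Matrix n} →
               (∀ i j → j ≢ k → M i j ≈ A i j) → (∀ i j → j ≢ k → M i j ≈ B i j) →
               (∀ i → M i k ≈ x · A i k ⊕ y · B i k) → detᴿ M ≈ x · detᴿ A ⊕ y · detᴿ B
  det-linear {suc n} k x y {M} {A} {B} M≈A M≈B M≈xA+yB = begin
    sum (cofactor M)                                               ≈⟨ sum-cong-≋ term ⟩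
    sum (λ j → x · cofactor A j ⊕ y · cofactor B j)                ≈⟨ ∑-distrib-+ (λ j → x · cofactor A j) (λ j → y · cofactor B j) ⟩
    sum (λ j → x · cofactor A j) ⊕ sum (λ j → y · cofactor B j)    ≈⟨ +-cong (*-distribˡ-sum x (cofactor A)) (*-distribˡ-sum y (cofactor B)) ⟨
    x · sum (cofactor A) ⊕ y · sum (cofactor B)                    ∎
    where
    open Solver using (solve; _:=_; _:+_; _:*_)

    term : ∀ j → cofactor M j ≈ x · cofactor A j ⊕ y · cofactor B j
    term j with j Fin.≟ k
    ... | yes refl = begin
      s · (M zero j · detᴿ (minorᴿ M j))                              ≈⟨ *-congˡ (*-congʳ (M≈xA+yB zero)) ⟩
      s · ((x · A zero j ⊕ y · B zero j) · detᴿ (minorᴿ M j))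
        ≈⟨ solve 6 (λ s x a y b d → (s :* ((x :* a :+ y :* b) :* d)) := (x :* (s :* (a :* d)) :+ y :* (s :* (b :* d)))) ≈-refl s x (A zero j) y (B zero j) (detᴿ (minorᴿ M j)) ⟩
      x · (s · (A zero j · detᴿ (minorᴿ M j))) ⊕ y · (s · (B zero j · detᴿ (minorᴿ M j)))
        ≈⟨ +-cong (*-congˡ (*-congˡ (*-congˡ (det-cong λ i l → M≈A (suc i) (punchIn j l) (Fin.punchInᵢ≢i j l)))))
                  (*-congˡ (*-congˡ (*-congˡ (det-cong λ i l → M≈B (suc i) (punchIn j l) (Fin.punchInᵢ≢i j l))))) ⟩
      x · cofactor A j ⊕ y · cofactor B j ∎
      where s = (- 1#) ^ᴿ toℕ j
    ... | no j≢k = begin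
      s · (M zero j · detᴿ (minorᴿ M j))
        ≈⟨ *-congˡ (*-congˡ (det-linear k′ x y
             (λ i l l≢ → M≈A (suc i) (punchIn j l) (punchIn≢k l≢))
             (λ i l l≢ → M≈B (suc i) (punchIn j l) (punchIn≢k l≢))
             (λ i → subst (λ m → M (suc i) m ≈ x · A (suc i) m ⊕ y · B (suc i) m) (sym k′↦k) (M≈xA+yB (suc i))))) ⟩
      s · (M zero j · (x · detᴿ (minorᴿ A j) ⊕ y · detᴿ (minorᴿ B j)))
        ≈⟨ solve 6 (λ s m x a y b → (s :* (m :* (x :* a :+ y :* b))) := (x :* (s :* (m :* a)) :+ y :* (s :* (m :* b)))) ≈-refl s (M zero j) x (detᴿ (minorᴿ A j)) y (detᴿ (minorᴿ B j)) ⟩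
      x · (s · (M zero j · detᴿ (minorᴿ A j))) ⊕ y · (s · (M zero j · detᴿ (minorᴿ B j)))
        ≈⟨ +-cong (*-congˡ (*-congˡ (*-congʳ (M≈A zero j j≢k)))) (*-congˡ (*-congˡ (*-congʳ (M≈B zero j j≢k)))) ⟩
      x · cofactor A j ⊕ y · cofactor B j ∎
      where
      s = (- 1#) ^ᴿ toℕ j
      k′ = punchOut j≢k
      k′↦k = Fin.punchIn-punchOut j≢k
      punchIn≢k : ∀ {l} → l ≢ k′ → punchIn j l ≢ k
      punchIn≢k l≢k′ eq = l≢k′ (Fin.punchIn-injective j _ _ (trans eq (sym k′↦k)))

  -- A relation rather than an operation on matrices, so that it restricts to minors, and a matrix
  -- with two equal adjacent columns is related to itself.
  record AdjacentSwap {m n} (k : Fin n) (A B : Vector (Vector Carrier (suc n)) m) : Set ℓ where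
    field
      off   : ∀ i j → j ≢ inject₁ k → j ≢ suc k → A i j ≈ B i j
      left  : ∀ i → A i (inject₁ k) ≈ B i (suc k)
      right : ∀ i → A i (suc k) ≈ B i (inject₁ k)

  swap-sym : ∀ {m n} {k : Fin n} {A B : Vector (Vector Carrier (suc n)) m} → AdjacentSwap k A B → AdjacentSwap k B A
  swap-sym sw = record
    { off   = λ i j p q → ≈-sym (off i j p q)
    ; left  = λ i → ≈-sym (right i)
    ; right = λ i → ≈-sym (left i)
    } where open AdjacentSwap sw

  -- Both deletions remove the same column, which sits at `inject₁ k` in `A` and at `suc k` in `B`;
  -- its former neighbour ends up at position `k` in both minors.
  minor-swap : ∀ {n} {k : Fin n} {A B : Matrix (suc n)} → AdjacentSwap k A B →
               ∀ i l → minorᴿ A (inject₁ k) i l ≈ minorᴿ B (suc k) i l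
  minor-swap {k = k} {A} {B} sw i l with l Fin.≟ k
  ... | yes refl rewrite punchIn-inject₁-self l | punchIn-suc-self l = AdjacentSwap.right sw (suc i)
  ... | no l≢k = ≈-trans
    (AdjacentSwap.off sw (suc i) (punchIn (inject₁ k) l) (Fin.punchInᵢ≢i (inject₁ k) l)
      (λ eq → Fin.punchInᵢ≢i (suc k) l (trans (sym (punchIn-inject₁-suc k l l≢k)) eq)))
    (≈-reflexive (cong (B (suc i)) (punchIn-inject₁-suc k l l≢k)))

  -- Away from the pair the two expansions cancel term by term, by induction on the minors. At the
  -- pair they cancel crosswise: entry and minor agree, while the positions differ by one and so the
  -- signs are opposite.
  det-swap : ∀ {n} (k : Fin n) {A B : Matrix (suc n)} → AdjacentSwap k A B → detᴿ A ⊕ detᴿ B ≈ 0#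
  det-swap {suc n} k {A} {B} sw = begin
    sum (cofactor A) ⊕ sum (cofactor B)     ≈⟨ ∑-distrib-+ (cofactor A) (cofactor B) ⟨
    sum (λ j → cofactor A j ⊕ cofactor B j) ≈⟨ sum-adjacent-cancel k _ off-pair on-pair ⟩
    0#                                      ∎
    where
    open Solver using (solve; _:=_; _:+_; _:*_)
    open AdjacentSwap sw

    off-pair : ∀ j → j ≢ inject₁ k → j ≢ suc k → cofactor A j ⊕ cofactor B j ≈ 0#
    off-pair j j≢k j≢k+1 with k′ , eq , eq′ ← punchOut-adjacent j k j≢k j≢k+1 = begin
      s · (A zero j · detᴿ (minorᴿ A j)) ⊕ s · (B zero j · detᴿ (minorᴿ B j))
        ≈⟨ +-congˡ (*-congˡ (*-congʳ (≈-sym (off zero j j≢k j≢k+1)))) ⟩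
      s · (A zero j · detᴿ (minorᴿ A j)) ⊕ s · (A zero j · detᴿ (minorᴿ B j))
        ≈⟨ solve 4 (λ s a d e → (s :* (a :* d) :+ s :* (a :* e)) := ((s :* a) :* (d :+ e))) ≈-refl s (A zero j) (detᴿ (minorᴿ A j)) (detᴿ (minorᴿ B j)) ⟩
      (s · A zero j) · (detᴿ (minorᴿ A j) ⊕ detᴿ (minorᴿ B j))
        ≈⟨ *-congˡ (det-swap k′ minors) ⟩
      (s · A zero j) · 0#
        ≈⟨ zeroʳ _ ⟩
      0# ∎
      where
      s = (- 1#) ^ᴿ toℕ j
      minors : AdjacentSwap k′ (minorᴿ A j) (minorᴿ B j)
      minors = record
        { off   = λ i l p q → off (suc i) (punchIn j l)
                    (λ e → p (Fin.punchIn-injective j _ _ (trans e (sym eq))))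
                    (λ e → q (Fin.punchIn-injective j _ _ (trans e (sym eq′))))
        ; left  = λ i → ≈-trans (≈-reflexive (cong (A (suc i)) eq))
                          (≈-trans (left (suc i)) (≈-reflexive (cong (B (suc i)) (sym eq′))))
        ; right = λ i → ≈-trans (≈-reflexive (cong (A (suc i)) eq′))
                          (≈-trans (right (suc i)) (≈-reflexive (cong (B (suc i)) (sym eq))))
        }

    -- Quantified over both matrices because the reversed swap is needed as well.
    cancel : ∀ {A B} → AdjacentSwap k A B → cofactor A (inject₁ k) ⊕ cofactor B (suc k) ≈ 0#
    cancel {A} {B} sw = begin
      cofactor A (inject₁ k) ⊕ cofactor B (suc k)
        ≈⟨ +-congʳ (*-cong (≈-reflexive (cong ((- 1#) ^ᴿ_) (Fin.toℕ-inject₁ k)))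
                           (*-cong (AdjacentSwap.left sw zero) (det-cong (minor-swap sw)))) ⟩
      s · (B zero (suc k) · detᴿ (minorᴿ B (suc k))) ⊕ (- 1# · s) · (B zero (suc k) · detᴿ (minorᴿ B (suc k)))
        ≈⟨ distribʳ _ _ _ ⟨
      (s ⊕ - 1# · s) · _
        ≈⟨ *-congʳ (+-congʳ (*-identityˡ s)) ⟨
      (1# · s ⊕ - 1# · s) · _
        ≈⟨ *-congʳ (distribʳ s 1# (- 1#)) ⟨
      ((1# ⊕ - 1#) · s) · _
        ≈⟨ *-congʳ (≈-trans (*-congʳ (-‿inverseʳ 1#)) (zeroˡ s)) ⟩
      0# · _
        ≈⟨ zeroˡ _ ⟩
      0# ∎
      where
      s = (- 1#) ^ᴿ toℕ k

    on-pair : (cofactor A (inject₁ k) ⊕ cofactor B (inject₁ k)) ⊕ (cofactor A (suc k) ⊕ cofactor B (suc k)) ≈ 0#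
    on-pair = begin
      (cofactor A (inject₁ k) ⊕ cofactor B (inject₁ k)) ⊕ (cofactor A (suc k) ⊕ cofactor B (suc k))
        ≈⟨ solve 4 (λ a b c d → ((a :+ b) :+ (c :+ d)) := ((a :+ d) :+ (b :+ c))) ≈-refl
             (cofactor A (inject₁ k)) (cofactor B (inject₁ k)) (cofactor A (suc k)) (cofactor B (suc k)) ⟩
      (cofactor A (inject₁ k) ⊕ cofactor B (suc k)) ⊕ (cofactor B (inject₁ k) ⊕ cofactor A (suc k))
        ≈⟨ +-cong (cancel sw) (cancel (swap-sym sw)) ⟩
      0# ⊕ 0#
        ≈⟨ +-identityˡ 0# ⟩
      0# ∎

  -- Expanding along the first row keeps the last column in every minor but the last, and that one
  -- is multiplied by a zero entry of the column. No sign arises because the corner lies on the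
  -- diagonal.
  det-last-column : ∀ {n} (M : Matrix (suc n)) → (∀ i → M (inject₁ i) (fromℕ n) ≈ 0#) →
                    detᴿ M ≈ M (fromℕ n) (fromℕ n) · detᴿ (λ i j → M (inject₁ i) (inject₁ j))
  det-last-column {zero}  M _  = ≈-trans (+-identityʳ _) (*-identityˡ _)
  det-last-column {suc n} M M≈0 = begin
    sum (cofactor M)
      ≈⟨ sum-init-last (cofactor M) ⟩
    sum (cofactor M ∘ inject₁) ⊕ cofactor M (fromℕ (suc n))
      ≈⟨ +-cong (sum-cong-≋ term) (≈-trans (*-congˡ (≈-trans (*-congʳ (M≈0 zero)) (zeroˡ _))) (zeroʳ _)) ⟩
    sum (λ j → corner · cofactor N j) ⊕ 0#
      ≈⟨ +-identityʳ _ ⟩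
    sum (λ j → corner · cofactor N j)
      ≈⟨ *-distribˡ-sum corner (cofactor N) ⟨
    corner · sum (cofactor N) ∎
    where
    open Solver using (solve; _:=_; _:+_; _:*_)
    corner = M (fromℕ (suc n)) (fromℕ (suc n))
    N : Matrix (suc n)
    N i j = M (inject₁ i) (inject₁ j)

    term : ∀ j → cofactor M (inject₁ j) ≈ corner · cofactor N j
    term j = begin
      ((- 1#) ^ᴿ toℕ (inject₁ j)) · (N zero j · detᴿ (minorᴿ M (inject₁ j)))
        ≈⟨ *-cong (≈-reflexive (cong ((- 1#) ^ᴿ_) (Fin.toℕ-inject₁ j)))
             (*-congˡ (det-last-column (minorᴿ M (inject₁ j))
               (λ i → ≈-trans (≈-reflexive (cong (M (suc (inject₁ i))) (punchIn-inject₁-fromℕ j))) (M≈0 (suc i))))) ⟩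
      s · (N zero j · (M (fromℕ (suc n)) (punchIn (inject₁ j) (fromℕ n)) · _))
        ≈⟨ *-congˡ (*-congˡ (*-cong (≈-reflexive (cong (M (fromℕ (suc n))) (punchIn-inject₁-fromℕ j)))
             (det-cong λ i l → ≈-reflexive (cong (M (suc (inject₁ i))) (punchIn-inject₁ j l))))) ⟩
      s · (N zero j · (corner · detᴿ (minorᴿ N j)))
        ≈⟨ solve 4 (λ s m c d → (s :* (m :* (c :* d))) := (c :* (s :* (m :* d)))) ≈-refl s (N zero j) corner (detᴿ (minorᴿ N j)) ⟩
      corner · cofactor N j ∎
      where s = (- 1#) ^ᴿ toℕ j

  insertColumn : ∀ {m n} → Vector (Vector Carrier n) m → Fin (suc n) → Vector Carrier m → Vector (Vector Carrier (suc n)) m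
  insertColumn N k u i = insertAt (N i) k (u i)

  insertColumn-swap : ∀ {m n} (N : Vector (Vector Carrier n) m) k u →
                      AdjacentSwap k (insertColumn N (inject₁ k) u) (insertColumn N (suc k) u)
  insertColumn-swap N k u = record
    { off   = λ i j p q → ≈-reflexive (insertAt-inject₁-suc (N i) k (u i) j p q)
    ; left  = λ i → ≈-reflexive (trans (insertAt-lookup (N i) (inject₁ k) (u i)) (sym (insertAt-lookup (N i) (suc k) (u i))))
    ; right = λ i → ≈-reflexive (trans (insertAt-inject₁-at-suc (N i) k (u i)) (sym (insertAt-suc-at-inject₁ (N i) k (u i))))
    }

  -- Antisymmetry alone only gives det + det ≈ 0, whence the hypothesis on R.
  det-repeated-column : (∀ x → x ⊕ x ≈ 0# → x ≈ 0#) →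
                        ∀ {n} (N : Vector (Vector Carrier n) (suc n)) c k → detᴿ (insertColumn N k (λ i → N i c)) ≈ 0#
  det-repeated-column torsion-free {n} N c = <-weakInduction P (down (inject₁ c) base) up
    where
    u : Vector Carrier (suc n)
    u i = N i c

    P : Fin (suc n) → Set ℓ
    P k = detᴿ (insertColumn N k u) ≈ 0#

    up : ∀ k → P (inject₁ k) → P (suc k)
    up k p = ≈-trans (≈-sym (≈-trans (+-congʳ p) (+-identityˡ _))) (det-swap k (insertColumn-swap N k u))

    down : ∀ k → P k → P zero
    down = <-weakInduction (λ k → P k → P zero) id λ k rec p →
      rec (≈-trans (≈-sym (≈-trans (+-congˡ p) (+-identityʳ _))) (det-swap k (insertColumn-swap N k u)))

    base : P (inject₁ c)
    -- Copy and original are adjacent here, so the matrix is its own swap.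
    base = torsion-free _ (det-swap c {insertColumn N (inject₁ c) u} {insertColumn N (inject₁ c) u} record
      { off   = λ i j p q → ≈-refl
      ; left  = λ i → ≈-reflexive (trans (insertAt-lookup (N i) (inject₁ c) (u i)) (sym (insertAt-inject₁-at-suc (N i) c (u i))))
      ; right = λ i → ≈-reflexive (trans (insertAt-inject₁-at-suc (N i) c (u i)) (sym (insertAt-lookup (N i) (inject₁ c) (u i))))
      })

-- Determinants are built from ring operations only. This allows the computation to take place over
-- ℤ, with a single transfer to ℚ at the end.
det-homo : ∀ {c₁ ℓ₁ c₂ ℓ₂} (R : CommutativeRing c₁ ℓ₁) (S : CommutativeRing c₂ ℓ₂) →
           let module R = CommutativeRing R; module S = CommutativeRing S in
           ∀ {f} → IsRingHomomorphism R.rawRing S.rawRing f →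
           ∀ {n} (M : Determinant.SquareMatrix R n) →
           f (Determinant.det R M) S.≈ Determinant.det S (λ i j → f (M i j))
det-homo R S {f} f-homo = go
  where
  module R = CommutativeRing R
  module S = CommutativeRing S
  open IsRingHomomorphism f-homo
  open import Algebra.Properties.Semiring.Sum R.semiring using () renaming (sum to sumR)
  open import Algebra.Properties.Semiring.Sum S.semiring using () renaming (sum to sumS; sum-cong-≋ to sumS-cong)
  open import Algebra.Properties.Semiring.Exp R.semiring using () renaming (_^_ to _^R_)
  open import Algebra.Properties.Semiring.Exp S.semiring using () renaming (_^_ to _^S_)

  sum-homo : ∀ {n} (h : Vector R.Carrier n) → f (sumR h) S.≈ sumS (f ∘ h)
  sum-homo {zero}  h = 0#-homo
  sum-homo {suc n} h = S.trans (+-homo _ _) (S.+-congˡ (sum-homo (h ∘ suc)))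

  sign-homo : ∀ k → f ((R.- R.1#) ^R k) S.≈ (S.- S.1#) ^S k
  sign-homo zero    = 1#-homo
  sign-homo (suc k) = S.trans (*-homo _ _) (S.*-cong (S.trans (-‿homo _) (S.-‿cong 1#-homo)) (sign-homo k))

  go : ∀ {n} (M : Determinant.SquareMatrix R n) →
       f (Determinant.det R M) S.≈ Determinant.det S (λ i j → f (M i j))
  go {zero}  M = 1#-homo
  go {suc n} M = S.trans (sum-homo cofactor) (sumS-cong {x = f ∘ cofactor} λ j →
    S.trans (*-homo ((R.- R.1#) ^R toℕ j) _) (S.*-cong (sign-homo (toℕ j))
      (S.trans (*-homo (M zero j) _) (S.*-congˡ (go (Determinant.minor R M j))))))
    where
    cofactor : Vector R.Carrier (suc n)
    cofactor j = (R.- R.1#) ^R toℕ j R.* (M zero j R.* Determinant.det R (Determinant.minor R M j))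

-- Hankel determinants over ℤ

open ColumnOperations ℤ.+-*-commutativeRing using (Matrix; detᴿ; det-cong; det-linear; det-last-column; insertColumn; det-repeated-column)

hankelℤ : (ℕ → ℤ) → (n : ℕ) → Matrix n
hankelℤ a n i j = a (toℕ i + toℕ j)

record IsLinear (F : (ℕ → ℤ) → ℤ) : Set where
  field
    F-cong : ∀ {s t} → (∀ i → s i ≡ t i) → F s ≡ F t
    linear : ∀ x y s t → F (λ i → x *ℤ s i +ℤ y *ℤ t i) ≡ x *ℤ F s +ℤ y *ℤ F t

-- "s = p(E) a for a polynomial p = c xⁿ + lower terms", where E is the shift operator;
-- testing against all linear functionals avoids coefficient vectors.
record Leads (a : ℕ → ℤ) (n : ℕ) (c : ℤ) (s : ℕ → ℤ) : Set where
  constructor leads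
  field
    evaluate : ∀ {F} → IsLinear F → (∀ k → k < n → F (λ i → a (i + k)) ≡ 0ℤ) → F s ≡ c *ℤ F (λ i → a (i + n))

open Leads using (evaluate)

module _ {a : ℕ → ℤ} where

  leads-self : ∀ {s} → (∀ i → s i ≡ a i) → Leads a 0 1ℤ s
  leads-self s≗a = leads λ F-linear _ → trans
    (IsLinear.F-cong F-linear λ i → trans (s≗a i) (cong a (sym (ℕ.+-identityʳ i))))
    (sym (ℤ.*-identityˡ _))

  leads-zero : ∀ {n s} → (∀ i → s i ≡ 0ℤ) → Leads a n 0ℤ s
  leads-zero {n} {s} s≗0 = leads λ {F} F-linear _ → let open IsLinear F-linear in begin
    F s                                     ≡⟨ F-cong (λ i → trans (s≗0 i) (sym (cong₂ _+ℤ_ (ℤ.*-zeroˡ (s i)) (ℤ.*-zeroˡ (s i))))) ⟩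
    F (λ i → 0ℤ *ℤ s i +ℤ 0ℤ *ℤ s i)        ≡⟨ linear 0ℤ 0ℤ s s ⟩
    0ℤ *ℤ F s +ℤ 0ℤ *ℤ F s                  ≡⟨ cong₂ _+ℤ_ (ℤ.*-zeroˡ (F s)) (ℤ.*-zeroˡ (F s)) ⟩
    0ℤ                                      ≡⟨ ℤ.*-zeroˡ (F (λ i → a (i + n))) ⟨
    0ℤ *ℤ F (λ i → a (i + n))               ∎
    where open ≡-Reasoning

  -- Multiplication of p by x: the hypothesis is applied to the functional t ↦ F (E t), which kills
  -- the shifts below n because F kills those below n + 1.
  leads-shift : ∀ {n c s} → Leads a n c s → Leads a (suc n) c (s ∘ suc)
  leads-shift {n} {c} s-leads = leads λ {F} F-linear F-kills → let open IsLinear F-linear in trans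
    (evaluate s-leads {λ t → F (t ∘ suc)}
      (record { F-cong = λ s≗t → F-cong (s≗t ∘ suc) ; linear = λ x y s t → linear x y (s ∘ suc) (t ∘ suc) })
      (λ k k<n → trans (F-cong λ i → cong a (sym (ℕ.+-suc i k))) (F-kills (suc k) (s≤s k<n))))
    (cong (c *ℤ_) (F-cong λ i → cong a (sym (ℕ.+-suc i n))))

  -- Read as a polynomial of formal degree n + 1, p has top coefficient 0; F now kills the shift by
  -- n too, so the former leading term drops out.
  leads-raise : ∀ {n c s} → Leads a n c s → Leads a (suc n) 0ℤ s
  leads-raise {n} {c} s-leads = leads λ {F} F-linear F-kills → trans
    (evaluate s-leads F-linear (λ k k<n → F-kills k (ℕ.m<n⇒m<1+n k<n)))
    (trans (cong (c *ℤ_) (F-kills n ℕ.≤-refl)) (trans (ℤ.*-zeroʳ c) (sym (ℤ.*-zeroˡ (F (λ i → a (i + suc n)))))))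

  leads-combination : ∀ {n c d s t} x y {r} → Leads a n c s → Leads a n d t →
                      (∀ i → r i ≡ x *ℤ s i +ℤ y *ℤ t i) → Leads a n (x *ℤ c +ℤ y *ℤ d) r
  leads-combination {n} {c} {d} {s} {t} x y {r} s-leads t-leads r≗ = leads λ {F} F-linear F-kills →
    let open IsLinear F-linear; f = F (λ i → a (i + n)) in begin
    F r                                   ≡⟨ F-cong r≗ ⟩
    F (λ i → x *ℤ s i +ℤ y *ℤ t i)        ≡⟨ linear x y s t ⟩
    x *ℤ F s +ℤ y *ℤ F t                  ≡⟨ cong₂ (λ u v → x *ℤ u +ℤ y *ℤ v) (evaluate s-leads F-linear F-kills) (evaluate t-leads F-linear F-kills) ⟩
    x *ℤ (c *ℤ f) +ℤ y *ℤ (d *ℤ f)        ≡⟨ regroup x c y d f ⟩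
    (x *ℤ c +ℤ y *ℤ d) *ℤ f               ∎
    where
    open ≡-Reasoning
    regroup : ∀ x c y d f → x *ℤ (c *ℤ f) +ℤ y *ℤ (d *ℤ f) ≡ (x *ℤ c +ℤ y *ℤ d) *ℤ f
    regroup = solve-∀

ℤ-torsion-free : ∀ x → x +ℤ x ≡ 0ℤ → x ≡ 0ℤ
ℤ-torsion-free x x+x≡0 = ℤ.*-cancelˡ-≡ (+ 2) x 0ℤ (trans (double x) x+x≡0)
  where
  double : ∀ x → + 2 *ℤ x ≡ x +ℤ x
  double = solve-∀

-- Replacing the last column by s is a linear functional of s that kills the other columns.
hankel-step : ∀ {a n c s} → Leads a n c s → (∀ i → i < n → s i ≡ 0ℤ) →
              c *ℤ detᴿ (hankelℤ a (suc n)) ≡ s n *ℤ detᴿ (hankelℤ a n)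
hankel-step {a} {n} {c} {s} s-leads s≡0 = begin
  c *ℤ detᴿ (hankelℤ a (suc n))      ≡⟨ cong (c *ℤ_) (det-cong λ i j → insertAt-fromℕ-toℕ n (λ k → a (toℕ i + k)) j) ⟨
  c *ℤ F (λ i → a (i + n))           ≡⟨ evaluate s-leads F-linear F-kills ⟨
  -- As `s` vanishes below `n`, the last column is zero above the corner.
  F s                                ≡⟨ det-last-column (insertColumn N (fromℕ n) (s ∘ toℕ)) upper ⟩
  insertAt (N (fromℕ n)) (fromℕ n) (s (toℕ (fromℕ n))) (fromℕ n) *ℤ _
    ≡⟨ cong₂ _*ℤ_ (trans (insertAt-lookup (N (fromℕ n)) (fromℕ n) _) (cong s (Fin.toℕ-fromℕ n)))
         (det-cong λ i j → trans (insertAt-fromℕ-inject₁ (N (inject₁ i)) _ j) (cong (λ k → a (k + toℕ j)) (Fin.toℕ-inject₁ i))) ⟩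
  s n *ℤ detᴿ (hankelℤ a n)          ∎
  where
  open ≡-Reasoning
  N : Vector (Vector ℤ n) (suc n)
  N i j = a (toℕ i + toℕ j)

  F : (ℕ → ℤ) → ℤ
  F t = detᴿ (insertColumn N (fromℕ n) (t ∘ toℕ))

  F-linear : IsLinear F
  F-linear = record
    { F-cong = λ s≗t → det-cong λ i j → cong (λ v → insertAt (N i) (fromℕ n) v j) (s≗t (toℕ i))
    ; linear = λ x y s t → det-linear (fromℕ n) x y
        {insertColumn N (fromℕ n) (λ i → x *ℤ s (toℕ i) +ℤ y *ℤ t (toℕ i))}
        {insertColumn N (fromℕ n) (s ∘ toℕ)} {insertColumn N (fromℕ n) (t ∘ toℕ)}
        (λ i j → insertAt-minimal (N i) (fromℕ n) j)
        (λ i j → insertAt-minimal (N i) (fromℕ n) j)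
        (λ i → trans (insertAt-lookup (N i) (fromℕ n) (x *ℤ s (toℕ i) +ℤ y *ℤ t (toℕ i)))
          (sym (cong₂ (λ u v → x *ℤ u +ℤ y *ℤ v) (insertAt-lookup (N i) (fromℕ n) (s (toℕ i))) (insertAt-lookup (N i) (fromℕ n) (t (toℕ i))))))
    }

  F-kills : ∀ k → k < n → F (λ i → a (i + k)) ≡ 0ℤ
  -- The shift by `k` is already column `k`, so it occurs twice.
  F-kills k k<n = subst (λ m → F (λ i → a (i + m)) ≡ 0ℤ) (Fin.toℕ-fromℕ< k<n)
    (det-repeated-column ℤ-torsion-free N (fromℕ< k<n) (fromℕ n))

  upper : ∀ i → insertAt (N (inject₁ i)) (fromℕ n) (s (toℕ (inject₁ i))) (fromℕ n) ≡ 0ℤ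
  upper i = trans (insertAt-lookup (N (inject₁ i)) (fromℕ n) _)
    (s≡0 _ (subst (_< n) (sym (Fin.toℕ-inject₁ i)) (Fin.toℕ<n i)))

-- Ballot numbers

-- ballot n (k + 1) = Λ(xⁿ pₖ); the index is shifted so that p₋₁ = 0 is included.
ballot : ℕ → ℕ → ℤ
ballot n k = + (suc (n * 2) C (n + k)) -ℤ + (suc (n * 2) C suc (n + k))

-- The two middle binomials of the odd row 2n + 1 are equal; this is the convention p₋₁ = 0.
ballot-zero : ∀ n → ballot n 0 ≡ 0ℤ
ballot-zero n = ℤ.i≡j⇒i-j≡0 (cong +_ (begin
  suc (n * 2) C (n + 0)            ≡⟨ nCk≡nC[n∸k] n+0≤ ⟩
  suc (n * 2) C (suc (n * 2) ∸ (n + 0)) ≡⟨ cong (suc (n * 2) C_) complement ⟩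
  suc (n * 2) C suc (n + 0)        ∎))
  where
  open ≡-Reasoning
  split : ∀ n → suc (n * 2) ≡ (n + 0) + suc (n + 0)
  split = ℕ-Solver.solve-∀
  n+0≤ : n + 0 ≤ suc (n * 2)
  n+0≤ = subst (n + 0 ≤_) (sym (split n)) (ℕ.m≤m+n _ _)
  complement : suc (n * 2) ∸ (n + 0) ≡ suc (n + 0)
  complement = trans (cong (_∸ (n + 0)) (split n)) (ℕ.m+n∸m≡n (n + 0) _)

1+n*2≡n+1+n : ∀ n → suc (n * 2) ≡ n + suc n
1+n*2≡n+1+n = ℕ-Solver.solve-∀

-- Orthogonality, Λ(xⁿ pⱼ) = 0 for j = k - 1 > n: both binomials lie beyond the end of row 2n + 1.
ballot-above : ∀ n k → suc n < k → ballot n k ≡ 0ℤ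
ballot-above n k n+1<k = cong₂ (λ u v → + u -ℤ + v) (k>n⇒nCk≡0 big) (k>n⇒nCk≡0 (ℕ.m<n⇒m<1+n big))
  where
  big : suc (n * 2) < n + k
  big = subst (_< n + k) (sym (1+n*2≡n+1+n n)) (ℕ.+-monoʳ-< n n+1<k)

-- This is Λ(xⁿ pₙ), the squared norm of pₙ; only the last binomial of row 2n + 1 survives.
ballot-diagonal : ∀ n → ballot n (suc n) ≡ 1ℤ
ballot-diagonal n = cong₂ (λ u v → + u -ℤ + v)
  (trans (cong (suc (n * 2) C_) (sym (1+n*2≡n+1+n n))) (nCn≡1 (suc (n * 2))))
  (k>n⇒nCk≡0 (s≤s (ℕ.≤-reflexive (1+n*2≡n+1+n n))))

pascal-twice : ∀ n k → + (suc (suc n) C suc (suc k)) ≡ + (n C k) +ℤ + 2 *ℤ + (n C suc k) +ℤ + (n C suc (suc k))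
pascal-twice n k = begin
  + (suc (suc n) C suc (suc k))                                   ≡⟨ pascal (suc n) (suc k) ⟩
  + (suc n C suc k) +ℤ + (suc n C suc (suc k))                    ≡⟨ cong₂ _+ℤ_ (pascal n k) (pascal n (suc k)) ⟩
  + (n C k) +ℤ + (n C suc k) +ℤ (+ (n C suc k) +ℤ + (n C suc (suc k))) ≡⟨ collect (+ (n C k)) (+ (n C suc k)) (+ (n C suc (suc k))) ⟩
  + (n C k) +ℤ + 2 *ℤ + (n C suc k) +ℤ + (n C suc (suc k))        ∎
  where
  open ≡-Reasoning
  pascal : ∀ n k → + (suc n C suc k) ≡ + (n C k) +ℤ + (n C suc k)
  pascal n k = trans (cong +_ (sym (nCk+nC[k+1]≡[n+1]C[k+1] n k))) (ℤ.pos-+ (n C k) (n C suc k))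
  collect : ∀ x y z → x +ℤ y +ℤ (y +ℤ z) ≡ x +ℤ + 2 *ℤ y +ℤ z
  collect = solve-∀

-- The three-term recurrence x pₖ = pₖ₋₁ + 2 pₖ + pₖ₊₁. It is Pascal's rule applied twice, as the
-- upper index 2n + 1 grows by two.
ballot-suc : ∀ n k → ballot (suc n) (suc k) ≡ ballot n k +ℤ + 2 *ℤ ballot n (suc k) +ℤ ballot n (suc (suc k))
ballot-suc n k rewrite ℕ.+-suc n (suc k) | ℕ.+-suc n k = trans
  (cong₂ _-ℤ_ (pascal-twice N K) (pascal-twice N (suc K)))
  (regroup (+ (N C K)) (+ (N C suc K)) (+ (N C suc (suc K))) (+ (N C suc (suc (suc K)))))
  where
  N = suc (n * 2)
  K = n + k
  regroup : ∀ w x y z → (w +ℤ + 2 *ℤ x +ℤ y) -ℤ (x +ℤ + 2 *ℤ y +ℤ z)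
                      ≡ (w -ℤ x) +ℤ + 2 *ℤ (x -ℤ y) +ℤ (y -ℤ z)
  regroup = solve-∀

-- Since p₁ = x - 2, this is the moment Λ(xⁿ x (x - 2)); `catalan⁴-closed` matches it with the
-- closed form.
catalan⁴ : ℕ → ℤ
catalan⁴ n = ballot (suc n) 2

-- Columns of the orthogonal polynomials for the moments.

-- evenColumn m i = Λ(xⁱ x (x - 2) q) for q = p₂ₘ₊₁ / (x - 2).
evenColumn : ℕ → ℕ → ℤ
evenColumn m i = ballot (suc i) (2 + m * 2)

-- ((E - 2)² - 2) σₖ₊₂ = σₖ + σₖ₊₄ for the columns σₖ of the ballot numbers.
ballot-step₂ : ∀ n k → ballot n (4 + k) ≡
  1ℤ *ℤ (1ℤ *ℤ ballot (2 + n) (2 + k) +ℤ -[1+ 3 ] *ℤ ballot (1 + n) (2 + k)) +ℤ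
  1ℤ *ℤ (+ 2 *ℤ ballot n (2 + k) +ℤ -1ℤ *ℤ ballot n k)
ballot-step₂ n k rewrite ballot-suc (suc n) (suc k)
  | ballot-suc n k | ballot-suc n (suc k) | ballot-suc n (suc (suc k))
  = expand (ballot n k) (ballot n (1 + k)) (ballot n (2 + k)) (ballot n (3 + k)) (ballot n (4 + k))
  where
  expand : ∀ v w x y z → z ≡
    1ℤ *ℤ (1ℤ *ℤ ((v +ℤ + 2 *ℤ w +ℤ x) +ℤ + 2 *ℤ (w +ℤ + 2 *ℤ x +ℤ y) +ℤ (x +ℤ + 2 *ℤ y +ℤ z)) +ℤ -[1+ 3 ] *ℤ (w +ℤ + 2 *ℤ x +ℤ y)) +ℤ
    1ℤ *ℤ (+ 2 *ℤ x +ℤ -1ℤ *ℤ v)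
  expand = solve-∀

-- Only the pₖ with odd k are divisible by x - 2, so the recurrence goes in steps of two and the
-- induction carries the preceding column, of lower degree, along. It starts from p₁ / (x - 2) = 1
-- and p₋₁ = 0.
evenColumn-leads′ : ∀ m → Leads catalan⁴ (m * 2) 1ℤ (evenColumn m)
                        × Leads catalan⁴ (m * 2) 0ℤ (λ i → ballot (suc i) (m * 2))
evenColumn-leads′ zero    = leads-self (λ _ → refl) , leads-zero (λ i → ballot-zero (suc i))
evenColumn-leads′ (suc m) with now , prev ← evenColumn-leads′ m =
  leads-combination 1ℤ 1ℤ
    -- Here E² - 4E, and below 2 minus the preceding column: only E² reaches degree 2m + 2, so the
    -- leading coefficient stays 1.
    (leads-combination 1ℤ -[1+ 3 ] (leads-shift (leads-shift now)) (leads-raise (leads-shift now)) (λ _ → refl))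
    (leads-combination (+ 2) -1ℤ (leads-raise (leads-raise now)) (leads-raise (leads-raise prev)) (λ _ → refl))
    (λ i → ballot-step₂ (suc i) (m * 2)) ,
  leads-raise (leads-raise now)

evenColumn-leads : ∀ m → Leads catalan⁴ (m * 2) 1ℤ (evenColumn m)
evenColumn-leads m = proj₁ (evenColumn-leads′ m)

-- oddColumn m i = Λ(xⁱ x (x - 2) q) for q = (m p₂ₘ₊₁ - (m + 1) p₂ₘ₋₁) / (x (x - 2)).
oddColumn : ℕ → ℕ → ℤ
oddColumn m i = + m *ℤ ballot i (2 + m * 2) -ℤ + suc m *ℤ ballot i (m * 2)

-- From p₂ₘ₊₃ - 2 p₂ₘ₊₁ + p₂ₘ₋₁ = ((x - 2)² - 4) p₂ₘ₊₁ = x (x - 4) p₂ₘ₊₁, times m + 1. The factor x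
-- is already contained in `evenColumn m`, which leaves (m + 1) (E - 4).
oddColumn-suc : ∀ m i → oddColumn (suc m) i ≡
  1ℤ *ℤ oddColumn m i +ℤ 1ℤ *ℤ (+ suc m *ℤ evenColumn m (suc i) +ℤ (-[1+ 3 ] *ℤ + suc m) *ℤ evenColumn m i)
oddColumn-suc m i
  rewrite ballot-suc (suc i) (1 + m * 2) | ballot-suc i (m * 2) | ballot-suc i (1 + m * 2) | ballot-suc i (2 + m * 2)
  | ℤ.pos-+ 2 m | ℤ.pos-+ 1 m
  = expand (+ m) (ballot i (m * 2)) (ballot i (1 + m * 2)) (ballot i (2 + m * 2)) (ballot i (3 + m * 2)) (ballot i (4 + m * 2))
  where
  expand : ∀ m v w x y z → (1ℤ +ℤ m) *ℤ z -ℤ (+ 2 +ℤ m) *ℤ x ≡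
    1ℤ *ℤ (m *ℤ x -ℤ (1ℤ +ℤ m) *ℤ v) +ℤ
    1ℤ *ℤ ((1ℤ +ℤ m) *ℤ ((v +ℤ + 2 *ℤ w +ℤ x) +ℤ + 2 *ℤ (w +ℤ + 2 *ℤ x +ℤ y) +ℤ (x +ℤ + 2 *ℤ y +ℤ z))
            +ℤ (-[1+ 3 ] *ℤ (1ℤ +ℤ m)) *ℤ (w +ℤ + 2 *ℤ x +ℤ y))
  expand = solve-∀

mutual
  -- Bounding the degree by 2m instead of naming it 2m - 1 includes m = 0, where the polynomial is
  -- zero.
  oddColumn-low : ∀ m → Leads catalan⁴ (m * 2) 0ℤ (oddColumn m)
  oddColumn-low zero    = leads-zero λ i → cong₂ (λ u v → u -ℤ 1ℤ *ℤ v) (ℤ.*-zeroˡ (ballot i 2)) (ballot-zero i)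
  oddColumn-low (suc m) = leads-raise (oddColumn-leads m)

  -- By `oddColumn-suc` the top coefficient comes from (m + 1) E applied to the monic
  -- `evenColumn m`; all else has lower degree. Not dividing by m + 1 keeps the coefficients in ℤ.
  oddColumn-leads : ∀ m → Leads catalan⁴ (suc (m * 2)) (+ suc m) (oddColumn (suc m))
  oddColumn-leads m = subst (λ c → Leads catalan⁴ (suc (m * 2)) c (oddColumn (suc m))) (leading (+ suc m))
    (leads-combination 1ℤ 1ℤ (leads-raise (oddColumn-low m))
      (leads-combination (+ suc m) (-[1+ 3 ] *ℤ + suc m)
        (leads-shift (evenColumn-leads m)) (leads-raise (evenColumn-leads m)) (λ _ → refl))
      (oddColumn-suc m))
    where
    leading : ∀ c → 1ℤ *ℤ 0ℤ +ℤ 1ℤ *ℤ (c *ℤ 1ℤ +ℤ (-[1+ 3 ] *ℤ c) *ℤ 0ℤ) ≡ c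
    leading = solve-∀

-- Recurrences and values of the Hankel determinants.

H : ℕ → ℤ
H n = detᴿ (hankelℤ catalan⁴ n)

H-odd : ∀ m → H (suc (m * 2)) ≡ H (m * 2)
H-odd m = begin
  H (suc (m * 2))                        ≡⟨ ℤ.*-identityˡ _ ⟨
  1ℤ *ℤ H (suc (m * 2))                  ≡⟨ hankel-step (evenColumn-leads m) (λ i i<2m → ballot-above (suc i) _ (s≤s (s≤s i<2m))) ⟩
  evenColumn m (m * 2) *ℤ H (m * 2)      ≡⟨ cong (_*ℤ H (m * 2)) (ballot-diagonal (suc (m * 2))) ⟩
  1ℤ *ℤ H (m * 2)                        ≡⟨ ℤ.*-identityˡ _ ⟩
  H (m * 2)                              ∎
  where open ≡-Reasoning

H-even-suc : ∀ m → + suc m *ℤ H (suc m * 2) ≡ -ℤ (+ suc (suc m)) *ℤ H (suc (m * 2))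
H-even-suc m = begin
  + suc m *ℤ H (suc m * 2)                                 ≡⟨ hankel-step (oddColumn-leads m) vanish ⟩
  oddColumn (suc m) (suc (m * 2)) *ℤ H (suc (m * 2))       ≡⟨ cong (_*ℤ H (suc (m * 2))) diagonal ⟩
  -ℤ (+ suc (suc m)) *ℤ H (suc (m * 2))                     ∎
  where
  open ≡-Reasoning
  vanish : ∀ i → i < suc (m * 2) → oddColumn (suc m) i ≡ 0ℤ
  vanish i i< = begin
    + suc m *ℤ ballot i (4 + m * 2) -ℤ + suc (suc m) *ℤ ballot i (2 + m * 2)
      ≡⟨ cong₂ (λ u v → + suc m *ℤ u -ℤ + suc (suc m) *ℤ v)
           (ballot-above i _ (s≤s (ℕ.m<n⇒m<1+n (ℕ.m<n⇒m<1+n i<)))) (ballot-above i _ (s≤s i<)) ⟩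
    + suc m *ℤ 0ℤ -ℤ + suc (suc m) *ℤ 0ℤ
      ≡⟨ cong₂ _-ℤ_ (ℤ.*-zeroʳ (+ suc m)) (ℤ.*-zeroʳ (+ suc (suc m))) ⟩
    0ℤ ∎
  -- At index 2m + 1 the p₂ₘ₊₃ part still vanishes, while p₂ₘ₊₁ contributes its norm 1.
  diagonal : oddColumn (suc m) (suc (m * 2)) ≡ -ℤ (+ suc (suc m))
  diagonal = begin
    + suc m *ℤ ballot (suc (m * 2)) (4 + m * 2) -ℤ + suc (suc m) *ℤ ballot (suc (m * 2)) (2 + m * 2)
      ≡⟨ cong₂ (λ u v → + suc m *ℤ u -ℤ + suc (suc m) *ℤ v)
           (ballot-above (suc (m * 2)) _ (s≤s (s≤s (s≤s (ℕ.n≤1+n _))))) (ballot-diagonal (suc (m * 2))) ⟩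
    + suc m *ℤ 0ℤ -ℤ + suc (suc m) *ℤ 1ℤ
      ≡⟨ cong₂ _-ℤ_ (ℤ.*-zeroʳ (+ suc m)) (ℤ.*-identityʳ (+ suc (suc m))) ⟩
    0ℤ -ℤ + suc (suc m)
      ≡⟨ ℤ.+-identityˡ _ ⟩
    -ℤ (+ suc (suc m)) ∎

H-even : ∀ m → H (m * 2) ≡ -1ℤ ^ℤ m *ℤ + suc m
H-even zero    = refl
-- The recurrence gives m + 1 times the claim; this nonzero factor cancels against the m + 1 in the
-- value of `H (m * 2)`.
H-even (suc m) = ℤ.*-cancelˡ-≡ (+ suc m) _ _ (begin
  + suc m *ℤ H (suc m * 2)                               ≡⟨ H-even-suc m ⟩
  -ℤ (+ suc (suc m)) *ℤ H (suc (m * 2))                   ≡⟨ cong (-ℤ (+ suc (suc m)) *ℤ_) (trans (H-odd m) (H-even m)) ⟩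
  -ℤ (+ suc (suc m)) *ℤ (-1ℤ ^ℤ m *ℤ + suc m)             ≡⟨ regroup (+ suc (suc m)) (-1ℤ ^ℤ m) (+ suc m) ⟩
  + suc m *ℤ (-1ℤ *ℤ -1ℤ ^ℤ m *ℤ + suc (suc m))          ∎)
  where
  open ≡-Reasoning
  regroup : ∀ x s y → -ℤ x *ℤ (s *ℤ y) ≡ y *ℤ (-1ℤ *ℤ s *ℤ x)
  regroup = solve-∀

-- From ℤ to ℚ

fromℤ : ℤ → ℚ
fromℤ i = i / 1

-- Unnormalised fractions avoid the gcd reduction in `_/_`. The second argument of `mkℚᵘ` is the
-- denominator minus one.
toℚᵘ-fromℤ : ∀ i → toℚᵘ (fromℤ i) ≃ mkℚᵘ i 0
toℚᵘ-fromℤ i = ℚ.toℚᵘ-fromℚᵘ (mkℚᵘ i 0)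

fromℤ-isRingHomomorphism : IsRingHomomorphism (CommutativeRing.rawRing ℤ.+-*-commutativeRing)
                                              (CommutativeRing.rawRing ℚ.+-*-commutativeRing) fromℤ
fromℤ-isRingHomomorphism = record
  { isSemiringHomomorphism = record
    { isNearSemiringHomomorphism = record
      { +-isMonoidHomomorphism = record
        { isMagmaHomomorphism = record
          { isRelHomomorphism = record { cong = cong fromℤ }
          ; homo = λ i j → ℚ.toℚᵘ-injective (begin
              toℚᵘ (fromℤ (i +ℤ j))                    ≈⟨ toℚᵘ-fromℤ (i +ℤ j) ⟩
              mkℚᵘ (i +ℤ j) 0                          ≈⟨ *≡* (over-one i j) ⟩
              mkℚᵘ i 0 ℚᵘ.+ mkℚᵘ j 0                   ≈⟨ ℚᵘ.+-cong (toℚᵘ-fromℤ i) (toℚᵘ-fromℤ j) ⟨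
              toℚᵘ (fromℤ i) ℚᵘ.+ toℚᵘ (fromℤ j)       ≈⟨ ℚ.toℚᵘ-homo-+ (fromℤ i) (fromℤ j) ⟨
              toℚᵘ (fromℤ i ℚ.+ fromℤ j)               ∎)
          }
        ; ε-homo = refl
        }
      ; *-homo = λ i j → ℚ.toℚᵘ-injective (begin
          toℚᵘ (fromℤ (i *ℤ j))                    ≈⟨ toℚᵘ-fromℤ (i *ℤ j) ⟩
          mkℚᵘ i 0 ℚᵘ.* mkℚᵘ j 0                   ≈⟨ ℚᵘ.*-cong (toℚᵘ-fromℤ i) (toℚᵘ-fromℤ j) ⟨
          toℚᵘ (fromℤ i) ℚᵘ.* toℚᵘ (fromℤ j)       ≈⟨ ℚ.toℚᵘ-homo-* (fromℤ i) (fromℤ j) ⟨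
          toℚᵘ (fromℤ i ℚ.* fromℤ j)               ∎)
      }
    ; 1#-homo = refl
    }
  ; -‿homo = λ i → ℚ.toℚᵘ-injective (begin
      toℚᵘ (fromℤ (-ℤ i))         ≈⟨ toℚᵘ-fromℤ (-ℤ i) ⟩
      ℚᵘ.- mkℚᵘ i 0              ≈⟨ ℚᵘ.-‿cong (toℚᵘ-fromℤ i) ⟨
      ℚᵘ.- toℚᵘ (fromℤ i)        ≈⟨ ℚ.toℚᵘ-homo‿- (fromℤ i) ⟨
      toℚᵘ (ℚ.- fromℤ i)         ∎)
  }
  where
  open import Relation.Binary.Reasoning.Setoid ℚᵘ.≃-setoid
  over-one : ∀ i j → (i +ℤ j) *ℤ 1ℤ ≡ (i *ℤ 1ℤ +ℤ j *ℤ 1ℤ) *ℤ 1ℤ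
  over-one = solve-∀

-- The absorption identity (k + 1) C(n, k + 1) = (n - k) C(n, k), freed of subtraction so that
-- Pascal's rule proves it by induction in ℕ.
C-absorption : ∀ n k → suc k * (n C suc k) + k * (n C k) ≡ n * (n C k)
C-absorption zero    zero    = refl
C-absorption zero    (suc k) = cong₂ _+_ (ℕ.*-zeroʳ (suc (suc k))) (ℕ.*-zeroʳ (suc k))
C-absorption (suc n) zero    = begin
  1 * (suc n C 1) + 0   ≡⟨ ℕ.+-identityʳ _ ⟩
  1 * (suc n C 1)       ≡⟨ ℕ.*-identityˡ _ ⟩
  suc n C 1             ≡⟨ nC1≡n (suc n) ⟩
  suc n                 ≡⟨ ℕ.*-identityʳ (suc n) ⟨
  suc n * 1             ≡⟨ cong (suc n *_) (sym (nC0≡1 (suc n))) ⟩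
  suc n * (suc n C 0)   ∎
  where
  open ≡-Reasoning
  nC0≡1 : ∀ n → n C 0 ≡ 1
  nC0≡1 n = trans (nCk≡nC[n∸k] {0} {n} z≤n) (nCn≡1 n)
C-absorption (suc n) (suc k) rewrite sym (nCk+nC[k+1]≡[n+1]C[k+1] n k) | sym (nCk+nC[k+1]≡[n+1]C[k+1] n (suc k)) = begin
  suc (suc k) * (y + z) + suc k * (x + y)                                  ≡⟨ regroup k x y z ⟩
  (suc k * y + k * x) + (suc (suc k) * z + suc k * y) + (x + y)            ≡⟨ cong₂ (λ u v → u + v + (x + y)) (C-absorption n k) (C-absorption n (suc k)) ⟩
  n * x + n * y + (x + y)                                                  ≡⟨ collect n x y ⟩
  suc n * (x + y)                                                          ∎
  where
  open ≡-Reasoning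
  x = n C k
  y = n C suc k
  z = n C suc (suc k)
  regroup : ∀ k x y z → suc (suc k) * (y + z) + suc k * (x + y) ≡ (suc k * y + k * x) + (suc (suc k) * z + suc k * y) + (x + y)
  regroup = ℕ-Solver.solve-∀
  collect : ∀ n x y → n * x + n * y + (x + y) ≡ suc n * (x + y)
  collect = ℕ-Solver.solve-∀

-- For the two binomials `x`, `y` of row 2n + 3, the difference is the moment and the sum is C(2n +
-- 4, n + 4) = C(2n + 4, n); absorption ties the one to the other.
catalan⁴-closed : ∀ n → catalan⁴ n *ℤ + (4 + 2 * n) ≡ + 4 *ℤ + ((2 * n + 4) C n)
catalan⁴-closed n = begin
  catalan⁴ n *ℤ + (4 + 2 * n)                        ≡⟨ cong (_*ℤ + (4 + 2 * n)) (cong₂ (λ u v → + (N C u) -ℤ + (N C v)) n+3 (cong suc n+3)) ⟩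
  (x -ℤ y) *ℤ + (4 + 2 * n)                          ≡⟨ cong ((x -ℤ y) *ℤ_) (ℤ.pos-+ 4 (2 * n)) ⟩
  (x -ℤ y) *ℤ (+ 4 +ℤ + (2 * n))                     ≡⟨ cong (λ u → (x -ℤ y) *ℤ (+ 4 +ℤ u)) (ℤ.pos-* 2 n) ⟩
  (x -ℤ y) *ℤ (+ 4 +ℤ + 2 *ℤ + n)                    ≡⟨ regroup (+ n) x y ⟩
  -- The bracket after the factor 2 is the difference of the two sides of `absorption`, hence 0.
  + 4 *ℤ (x +ℤ y) +ℤ + 2 *ℤ ((+ 3 +ℤ + n *ℤ + 2) *ℤ x -ℤ ((+ 4 +ℤ + n) *ℤ y +ℤ (+ 3 +ℤ + n) *ℤ x))
    ≡⟨ cong (λ u → + 4 *ℤ (x +ℤ y) +ℤ + 2 *ℤ u) (ℤ.i≡j⇒i-j≡0 (sym absorption)) ⟩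
  + 4 *ℤ (x +ℤ y) +ℤ 0ℤ                              ≡⟨ ℤ.+-identityʳ _ ⟩
  + 4 *ℤ (x +ℤ y)                                    ≡⟨ cong (+ 4 *ℤ_) (trans (sym (ℤ.pos-+ (N C (3 + n)) (N C (4 + n)))) (cong +_ (nCk+nC[k+1]≡[n+1]C[k+1] N (3 + n)))) ⟩
  + 4 *ℤ + (suc N C (4 + n))                         ≡⟨ cong (λ u → + 4 *ℤ + u) complement ⟩
  + 4 *ℤ + ((2 * n + 4) C n)                         ∎
  where
  open ≡-Reasoning
  N = suc (suc n * 2)
  x = + (N C (3 + n))
  y = + (N C (4 + n))

  n+3 : suc n + 2 ≡ 3 + n
  n+3 = cong suc (ℕ.+-comm n 2)

  regroup : ∀ n x y → (x -ℤ y) *ℤ (+ 4 +ℤ + 2 *ℤ n) ≡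
            + 4 *ℤ (x +ℤ y) +ℤ + 2 *ℤ ((+ 3 +ℤ n *ℤ + 2) *ℤ x -ℤ ((+ 4 +ℤ n) *ℤ y +ℤ (+ 3 +ℤ n) *ℤ x))
  regroup = solve-∀

  absorption : (+ 4 +ℤ + n) *ℤ y +ℤ (+ 3 +ℤ + n) *ℤ x ≡ (+ 3 +ℤ + n *ℤ + 2) *ℤ x
  absorption = begin
    + (4 + n) *ℤ y +ℤ + (3 + n) *ℤ x                          ≡⟨ cong₂ _+ℤ_ (ℤ.pos-* (4 + n) (N C (4 + n))) (ℤ.pos-* (3 + n) (N C (3 + n))) ⟨
    + ((4 + n) * (N C (4 + n)) +  (3 + n) * (N C (3 + n)))    ≡⟨ cong +_ (C-absorption N (3 + n)) ⟩
    + (N * (N C (3 + n)))                                     ≡⟨ ℤ.pos-* N (N C (3 + n)) ⟩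
    + N *ℤ x                                                  ≡⟨ cong (λ u → (+ 3 +ℤ u) *ℤ x) (ℤ.pos-* n 2) ⟩
    (+ 3 +ℤ + n *ℤ + 2) *ℤ x                                  ∎

  split : ∀ n → 2 * n + 4 ≡ n + (4 + n)
  split = ℕ-Solver.solve-∀

  suc-N : ∀ n → suc (suc (suc n * 2)) ≡ 2 * n + 4
  suc-N = ℕ-Solver.solve-∀

  complement : suc N C (4 + n) ≡ (2 * n + 4) C n
  complement = begin
    suc N C (4 + n)                       ≡⟨ cong₂ _C_ (suc-N n) (sym (trans (cong (_∸ n) (split n)) (ℕ.m+n∸m≡n n (4 + n)))) ⟩
    (2 * n + 4) C (2 * n + 4 ∸ n)         ≡⟨ nCk≡nC[n∸k] (subst (n ≤_) (sym (split n)) (ℕ.m≤m+n n (4 + n))) ⟨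
    (2 * n + 4) C n                       ∎

fromℤ-catalan⁴ : ∀ n → fromℤ (catalan⁴ n) ≡ C⁽⁴⁾ n
fromℤ-catalan⁴ n = ℚ.toℚᵘ-injective (begin
  toℚᵘ (fromℤ (catalan⁴ n))                                   ≈⟨ toℚᵘ-fromℤ (catalan⁴ n) ⟩
  mkℚᵘ (catalan⁴ n) 0                                         ≈⟨ *≡* cross ⟩
  mkℚᵘ (+ 4) (3 + 2 * n) ℚᵘ.* mkℚᵘ (+ b) 0                    ≈⟨ ℚᵘ.*-cong (ℚ.toℚᵘ-fromℚᵘ (mkℚᵘ (+ 4) (3 + 2 * n))) (toℚᵘ-fromℤ (+ b)) ⟨
  toℚᵘ (+ 4 / (4 + 2 * n)) ℚᵘ.* toℚᵘ (fromℤ (+ b))            ≈⟨ ℚ.toℚᵘ-homo-* (+ 4 / (4 + 2 * n)) (fromℤ (+ b)) ⟨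
  toℚᵘ (C⁽⁴⁾ n)                                               ∎)
  where
  open import Relation.Binary.Reasoning.Setoid ℚᵘ.≃-setoid
  b = (2 * n + 4) C n
  cross : catalan⁴ n *ℤ + ((4 + 2 * n) * 1) ≡ + 4 *ℤ + b *ℤ 1ℤ
  cross = trans (cong (λ d → catalan⁴ n *ℤ + d) (ℕ.*-identityʳ (4 + 2 * n)))
    (trans (catalan⁴-closed n) (sym (ℤ.*-identityʳ _)))

D⁽⁴⁾≡fromℤ-H : ∀ n → D⁽⁴⁾ n ≡ fromℤ (H n)
D⁽⁴⁾≡fromℤ-H n = sym (trans
  (det-homo ℤ.+-*-commutativeRing ℚ.+-*-commutativeRing fromℤ-isRingHomomorphism (hankelℤ catalan⁴ n))
  (ColumnOperations.det-cong ℚ.+-*-commutativeRing {A = λ i j → fromℤ (hankelℤ catalan⁴ n i j)} {B = hankel C⁽⁴⁾ n} λ i j → fromℤ-catalan⁴ (toℕ i + toℕ j)))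

theorem7p3 : ∀ (n : ℕ) →
    (D⁽⁴⁾ (2 * n) ≡ ((-1ℤ ^ℤ n) *ℤ (+ (n + 1))) / 1)
    × (D⁽⁴⁾ (2 * n + 1) ≡ ((-1ℤ ^ℤ n) *ℤ (+ (n + 1))) / 1)
theorem7p3 n = trans (D⁽⁴⁾≡fromℤ-H (2 * n)) (cong fromℤ even) , trans (D⁽⁴⁾≡fromℤ-H (2 * n + 1)) (cong fromℤ odd)
  where
  even : H (2 * n) ≡ -1ℤ ^ℤ n *ℤ + (n + 1)
  even = trans (cong H (ℕ.*-comm 2 n)) (trans (H-even n) (cong (λ k → -1ℤ ^ℤ n *ℤ + k) (ℕ.+-comm 1 n)))
  odd : H (2 * n + 1) ≡ -1ℤ ^ℤ n *ℤ + (n + 1)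
  odd = trans (cong H (trans (ℕ.+-comm (2 * n) 1) (cong suc (ℕ.*-comm 2 n))))
    (trans (H-odd n) (trans (cong H (ℕ.*-comm n 2)) even))
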